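{- An infinite word over a finite alphabet is recurrent, balanced and rich if and only if it is a balanced episturmian word.
   Context: A finite word $w$ is rich if it has exactly $|w|+1$ distinct palindromic factors (including the empty word); an infinite word is rich if all its factors are rich. An infinite word is recurrent if each of its factors occurs infinitely often in it. A word is balanced if for any two factors $u,v$ with $|u|=|v|$ and any letter $x$, $||u|_x-|v|_x|\le 1$, where $|u|_x$ is the number of occurrences of $x$ in $u$. An infinite word $\mathbf t$ is episturmian if its set of factors is closed under reversal and, for each $n$, it has at most one factor $u$ of length $n$ that is right special (i.e. $ux$ and $uy$ are factors for two distinct letters $x\ne y$). -}

module Defs where

open import Data.Nat using (ℕ; zero; suc; _+_; _≤_)
open import Data.Fin using (Fin)
open import Data.Fin.Properties using (_≟_)
open import Data.List using (List; []; _∷_; _++_; length; reverse; filter; [_])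
open import Data.List.Membership.Propositional using (_∈_)
open import Data.List.Relation.Unary.Unique.Propositional using (Unique)
open import Data.Product using (Σ; ∃; ∃-syntax; _×_)
open import Relation.Binary.PropositionalEquality using (_≡_; _≢_)
open import Function.Bundles using (_⇔_)

Word : ℕ → Set
Word k = List (Fin k)

InfWord : ℕ → Set
InfWord k = ℕ → Fin k

slice : ∀ {k} → InfWord k → ℕ → ℕ → Word k
slice t i zero = []
slice t i (suc n) = t i ∷ slice t (suc i) n

OccursAt : ∀ {k} → InfWord k → Word k → ℕ → Set
OccursAt t u i = slice t i (length u) ≡ u

IsFactor : ∀ {k} → InfWord k → Word k → Set
IsFactor t u = ∃[ i ] OccursAt t u i

IsFinFactor : ∀ {k} → Word k → Word k → Set
IsFinFactor v w = ∃[ x ] ∃[ y ] (w ≡ x ++ v ++ y)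

IsPalindrome : ∀ {k} → Word k → Set
IsPalindrome v = reverse v ≡ v

-- w has exactly |w|+1 distinct palindromic factors (empty word included):
-- there is a duplicate-free list enumerating exactly its palindromic factors,
-- of length |w|+1.
RichFin : ∀ {k} → Word k → Set
RichFin {k} w = Σ (List (Word k)) λ P →
  Unique P × (∀ v → (v ∈ P) ⇔ (IsPalindrome v × IsFinFactor v w)) × (length P ≡ suc (length w))

Rich : ∀ {k} → InfWord k → Set
Rich t = ∀ u → IsFactor t u → RichFin u

Recurrent : ∀ {k} → InfWord k → Set
Recurrent t = ∀ u → IsFactor t u → ∀ N → ∃[ i ] (N ≤ i × OccursAt t u i)

count : ∀ {k} → Fin k → Word k → ℕ
count x u = length (filter (_≟ x) u)

Balanced : ∀ {k} → InfWord k → Set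
Balanced {k} t = ∀ u v → IsFactor t u → IsFactor t v → length u ≡ length v →
  ∀ (x : Fin k) → count x u ≤ suc (count x v) × count x v ≤ suc (count x u)

RightSpecial : ∀ {k} → InfWord k → Word k → Set
RightSpecial {k} t u = Σ (Fin k) λ x → Σ (Fin k) λ y →
  x ≢ y × IsFactor t (u ++ [ x ]) × IsFactor t (u ++ [ y ])

Episturmian : ∀ {k} → InfWord k → Set
Episturmian t =
  (∀ u → IsFactor t u → IsFactor t (reverse u)) ×
  (∀ n u v → length u ≡ n → length v ≡ n → RightSpecial t u → RightSpecial t v → u ≡ v)

{-# OPTIONS --safe #-}
module Submission where

-- Idea. Call a letter x a hub of a set L of words if every word of length 2 in L contains x. Then
-- every word of L is, up to its ends, an image under ψ : x ↦ x, y ↦ xy, and L′ = { w | ψ(w)x ∈ L }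
-- is again closed under factors and reversal. It inherits balance, uniqueness of right special
-- words, and the form of richness used here: every word has a palindromic prefix that occurs in it
-- only once. Working with sets of words instead of infinite words makes L′ immediate to define.
--
-- (⇒) Two distinct right special words of minimal length are av and bv. If v is empty, balance
-- excludes squares of letters and puts a common letter z into all words of length 3, so that
-- z g c z with g ≠ c occurs, contradicting richness. Otherwise the last letter of v is a hub, v is
-- ψ(v′)x, and av′, bv′ are shorter right special words of L′.
--
-- (⇐) Closure under reversal gives recurrence, hence a hub; a palindromic prefix occurring once in
-- the desubstituted word yields one of the given word, by induction on the length. The existence of
-- a hub is used only doubly negated: having such a prefix is decidable.

open import Defs
open import Data.Empty using (⊥; ⊥-elim)
open import Data.Fin using (Fin)
open import Data.Fin.Properties using (_≟_)
open import Data.List using (List; []; _∷_; _++_; length; reverse; filter; take; drop; [_])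
open import Data.List.Membership.Propositional using (_∈_; find)
open import Data.List.Properties using (++-assoc; ++-identityʳ; ++-cancelˡ; ∷-injective; ∷-injectiveˡ; ∷-injectiveʳ; ∷ʳ-injectiveˡ; ∷ʳ-injectiveʳ; length-++; length-reverse; reverse-++; reverse-involutive; unfold-reverse; filter-++; filter-accept; filter-reject; filter-all; ≡-dec; take++drop≡id; length-take; length-drop)
open import Data.List.Relation.Unary.All as All using (All; []; _∷_; all?)
open import Data.List.Relation.Unary.All.Properties using (¬All⇒Any¬)
open import Data.List.Relation.Unary.AllPairs using ([]; _∷_)
open import Data.List.Relation.Unary.Any using (here; there)
open import Data.List.Relation.Unary.Unique.Propositional using (Unique)
open import Data.List.Relation.Unary.Unique.Propositional.Properties using (filter⁺)
open import Data.List.Membership.Propositional.Properties using (∈-filter⁻)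
open import Data.Nat using (ℕ; zero; suc; _+_; _∸_; _≤_; _<_; z≤n; s≤s)
open import Data.Nat.Properties hiding (_≟_)
open import Algebra.Properties.CommutativeSemigroup +-commutativeSemigroup using (interchange)
open import Data.Product using (∃; ∃₂; _×_; _,_; proj₁; proj₂)
open import Data.Sum using (_⊎_; inj₁; inj₂)
open import Function using (_∘_)
open import Function.Bundles using (_⇔_; mk⇔; module Equivalence)
open import Relation.Binary.PropositionalEquality using (_≡_; _≢_; refl; sym; trans; cong; cong₂; subst; module ≡-Reasoning)
open import Relation.Nullary using (Dec; yes; no; ¬_; contradiction)
open import Relation.Nullary.Decidable using (map′; decidable-stable; _×-dec_; _⊎-dec_; ¬?)
open import Relation.Unary using (Decidable)

variable
  k : ℕ

-- Words

snoc-view : (a : Fin k) (w : Word k) → ∃₂ λ s e → a ∷ w ≡ s ++ [ e ]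
snoc-view a [] = [] , a , refl
snoc-view a (b ∷ w) with s , e , eq ← snoc-view b w = a ∷ s , e , cong (a ∷_) eq

prefixes-comparable : (a c : Word k) {b d : Word k} → a ++ b ≡ c ++ d →
  (∃ λ r → a ≡ c ++ r) ⊎ (∃ λ r → c ≡ a ++ r)
prefixes-comparable a [] _ = inj₁ (a , refl)
prefixes-comparable [] c@(_ ∷ _) _ = inj₂ (c , refl)
prefixes-comparable (x ∷ a) (y ∷ c) eq with refl , eq′ ← ∷-injective eq
  with prefixes-comparable a c eq′
... | inj₁ (r , refl) = inj₁ (r , refl)
... | inj₂ (r , refl) = inj₂ (r , refl)

prefix-of-init : (w m : Word k) {a b : Fin k} {t : Word k} →
  w ++ [ a ] ≡ m ++ b ∷ t → ∃ λ t′ → w ≡ m ++ t′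
prefix-of-init w [] _ = w , refl
prefix-of-init [] (c ∷ []) ()
prefix-of-init [] (c ∷ d ∷ m) ()
prefix-of-init (d ∷ w) (c ∷ m) eq with refl , eq′ ← ∷-injective eq
  with t′ , refl ← prefix-of-init w m eq′ = t′ , refl

reverse-cons-snoc : (a : Fin k) (w : Word k) (b : Fin k) →
  reverse (a ∷ w ++ [ b ]) ≡ b ∷ reverse w ++ [ a ]
reverse-cons-snoc a w b = trans (unfold-reverse a (w ++ [ b ]))
  (cong (_++ [ a ]) (reverse-++ w [ b ]))

strip-palindrome : (a : Fin k) (w : Word k) (b : Fin k) →
  IsPalindrome (a ∷ w ++ [ b ]) → b ≡ a × IsPalindrome w
strip-palindrome a w b pal
  with e₁ , e₂ ← ∷-injective (trans (sym (reverse-cons-snoc a w b)) pal) =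
  e₁ , ∷ʳ-injectiveˡ (reverse w) w e₂

palindrome-border : (v r : Word k) → IsPalindrome v → IsPalindrome (v ++ r) →
  v ++ r ≡ reverse r ++ v
palindrome-border v r pv pvr =
  trans (sym pvr) (trans (reverse-++ v r) (cong (reverse r ++_) pv))

HasCore : Word k → Set
HasCore p = ∃₂ λ s r → (∃ λ z → p ≡ s ++ z ∷ z ∷ r) ⊎ (∃₂ λ z y → p ≡ s ++ z ∷ y ∷ z ∷ r)

-- Stripping equal outer letters ends at the centre, `z z` or `z y z`. The induction runs on a bound
-- because the stripped word is not a subterm.
palindrome-core : (n : ℕ) (p : Word k) → length p ≤ n → IsPalindrome p → 2 ≤ length p → HasCore p
palindrome-core (suc n) (a ∷ b ∷ w) (s≤s len) pal _
  with q , e , eq ← snoc-view b w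
  with refl , palq ← strip-palindrome a q e (subst (λ v → IsPalindrome (a ∷ v)) eq pal) =
  subst (λ v → HasCore (a ∷ v)) (sym eq) (go q palq (subst (λ v → length v ≤ n) eq len))
  where
  go : ∀ q → IsPalindrome q → length (q ++ [ a ]) ≤ n → HasCore (a ∷ q ++ [ a ])
  go [] _ _ = [] , [] , inj₁ (a , refl)
  go (y ∷ []) _ _ = [] , [] , inj₂ (a , y , refl)
  go q@(_ ∷ _ ∷ _) palq len
    with palindrome-core n q (≤-trans (≤-trans (m≤m+n _ _) (≤-reflexive (sym (length-++ q)))) len) palq (s≤s (s≤s z≤n))
  ... | s , r , inj₁ (z , eq) = a ∷ s , r ++ [ a ] ,
    inj₁ (z , cong (a ∷_) (trans (cong (_++ [ a ]) eq) (++-assoc s _ _)))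
  ... | s , r , inj₂ (z , y , eq) = a ∷ s , r ++ [ a ] ,
    inj₂ (z , y , cong (a ∷_) (trans (cong (_++ [ a ]) eq) (++-assoc s _ _)))
palindrome-core _ (_ ∷ []) _ _ (s≤s ())

-- Richness and unioccurrent palindromic prefixes

-- The letter `c` excludes exactly the occurrence at position 0, so `p` has no second occurrence,
-- overlapping ones included.
OncePalPrefix : Word k → Set
OncePalPrefix w = ∃ λ p → (∃ λ s → w ≡ p ++ s) × IsPalindrome p ×
  (∀ c s r → w ≢ c ∷ s ++ p ++ r)

somePrefix? : {Q : Word k → Set} → Decidable Q → ∀ w → Dec (∃ λ p → (∃ λ s → w ≡ p ++ s) × Q p)
somePrefix? Q? w@[] = map′ (λ q → [] , ([] , refl) , q) (λ { ([] , _ , q) → q }) (Q? [])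
somePrefix? {Q = Q} Q? (c ∷ w) = map′ to from (Q? [] ⊎-dec somePrefix? (Q? ∘ (c ∷_)) w)
  where
  to : Q [] ⊎ (∃ λ p → (∃ λ s → w ≡ p ++ s) × Q (c ∷ p)) → ∃ λ p → (∃ λ s → c ∷ w ≡ p ++ s) × Q p
  to (inj₁ q) = [] , (_ , refl) , q
  to (inj₂ (p , (s , refl) , q)) = c ∷ p , (s , refl) , q
  from : (∃ λ p → (∃ λ s → c ∷ w ≡ p ++ s) × Q p) → Q [] ⊎ (∃ λ p → (∃ λ s → w ≡ p ++ s) × Q (c ∷ p))
  from ([] , _ , q) = inj₁ q
  from (d ∷ p , (s , refl) , q) = inj₂ (p , (s , refl) , q)

_≟ʷ_ : (u v : Word k) → Dec (u ≡ v)
_≟ʷ_ = ≡-dec _≟_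

prefix? : (v w : Word k) → Dec (∃ λ y → w ≡ v ++ y)
prefix? v w = map′ (λ { (_ , e , refl) → e }) (λ e → v , e , refl) (somePrefix? (v ≟ʷ_) w)

factor? : (v w : Word k) → Dec (IsFinFactor v w)
factor? v [] = map′ (λ e → [] , e) (λ { ([] , e) → e }) (prefix? v [])
factor? v (c ∷ w) = map′
  (λ { (inj₁ e) → [] , e ; (inj₂ (x , y , refl)) → c ∷ x , y , refl })
  (λ { ([] , e) → inj₁ e ; (_ ∷ x , y , refl) → inj₂ (x , y , refl) })
  (prefix? v (c ∷ w) ⊎-dec factor? v w)

once? : (p w : Word k) → Dec (∀ c s r → w ≢ c ∷ s ++ p ++ r)
once? p [] = yes λ _ _ _ ()
once? p (a ∷ w) = map′ (λ ¬f c s r eq → ¬f (s , r , ∷-injectiveʳ eq))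
  (λ once (s , r , eq) → once a s r (cong (a ∷_) eq)) (¬? (factor? p w))

oncePalPrefix? : Decidable (OncePalPrefix {k})
oncePalPrefix? w = somePrefix? (λ p → (reverse p ≟ʷ p) ×-dec once? p w) w

-- By reversal, the shorter palindromic prefix is also a suffix of the longer one; there it starts
-- after the first letter, hence inside `w`.
shorter-palPrefix-recurs : (a : Fin k) {w v : Word k} (c : Fin k) (r s : Word k) →
  IsPalindrome v → IsPalindrome (v ++ c ∷ r) → a ∷ w ≡ (v ++ c ∷ r) ++ s → IsFinFactor v w
shorter-palPrefix-recurs a {w} {v} c r s palv palp eq with reverse (c ∷ r) in er
... | [] = contradiction (trans (sym (length-reverse (c ∷ r))) (cong length er)) λ ()
... | d ∷ q = q , s , ∷-injectiveʳ (begin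
  a ∷ w                     ≡⟨ eq ⟩
  (v ++ c ∷ r) ++ s         ≡⟨ cong (_++ s) (palindrome-border v (c ∷ r) palv palp) ⟩
  (reverse (c ∷ r) ++ v) ++ s ≡⟨ cong (λ q → (q ++ v) ++ s) er ⟩
  ((d ∷ q) ++ v) ++ s       ≡⟨ ++-assoc (d ∷ q) v s ⟩
  d ∷ q ++ v ++ s           ∎)
  where open ≡-Reasoning

palPrefix-factor-tail : (a : Fin k) (w p v : Word k) → IsPalindrome p → IsPalindrome v →
  (∃ λ s → a ∷ w ≡ p ++ s) → (∃ λ s → a ∷ w ≡ v ++ s) →
  p ≡ v ⊎ IsFinFactor p w ⊎ IsFinFactor v w
palPrefix-factor-tail a w p v palp palv (s , ep) (s′ , ev)
  with prefixes-comparable p v (trans (sym ep) ev)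
... | inj₁ ([] , refl) = inj₁ (++-identityʳ v)
... | inj₁ (c ∷ r , refl) = inj₂ (inj₂ (shorter-palPrefix-recurs a c r s palv palp ep))
... | inj₂ ([] , refl) = inj₁ (sym (++-identityʳ p))
... | inj₂ (c ∷ r , refl) = inj₂ (inj₁ (shorter-palPrefix-recurs a c r s′ palp palv ev))

length-≤-filter : {A : Set} {D : A → Set} (D? : Decidable D) (xs : List A) → Unique xs →
  (∀ {a b} → a ∈ xs → b ∈ xs → ¬ D a → ¬ D b → a ≡ b) → length xs ≤ suc (length (filter D? xs))
length-≤-filter D? [] _ _ = z≤n
length-≤-filter {D = D} D? (x ∷ xs) (x∉ ∷ uniq) same with D? x
... | yes _ = s≤s (length-≤-filter D? xs uniq λ a b → same (there a) (there b))
... | no ¬d = s≤s (≤-reflexive (cong length (sym (filter-all D? (All.tabulate λ {y} y∈ →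
  decidable-stable (D? y) λ ¬dy → All.lookup x∉ y∈ (same (here refl) (there y∈) ¬d ¬dy))))))

prefix-or-factor-tail : {a : Fin k} {w v : Word k} → IsFinFactor v (a ∷ w) →
  (∃ λ s → a ∷ w ≡ v ++ s) ⊎ IsFinFactor v w
prefix-or-factor-tail ([] , e) = inj₁ e
prefix-or-factor-tail (_ ∷ x , y , eq) = inj₂ (x , y , ∷-injectiveʳ eq)

-- Prepending a letter creates at most one new palindromic factor: a new one is a prefix, and of two
-- distinct palindromic prefixes the shorter recurs in the tail.
palFactors-bound : (w : Word k) (P : List (Word k)) → Unique P →
  (∀ {v} → v ∈ P → IsPalindrome v × IsFinFactor v w) → length P ≤ suc (length w)
palFactors-bound [] [] _ _ = z≤n
palFactors-bound [] (p ∷ []) _ _ = s≤s z≤n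
palFactors-bound [] (p ∷ q ∷ P) ((p≢q ∷ _) ∷ _) pf =
  contradiction (trans (empty (proj₂ (pf (here refl)))) (sym (empty (proj₂ (pf (there (here refl))))))) p≢q
  where
  empty : ∀ {v} → IsFinFactor v [] → v ≡ []
  empty {[]} _ = refl
  empty {_ ∷ _} ([] , _ , ())
  empty {_ ∷ _} (_ ∷ _ , _ , ())
palFactors-bound (a ∷ w) P uniq pf = ≤-trans
  (length-≤-filter (λ v → factor? v w) P uniq same)
  (s≤s (palFactors-bound w (filter (λ v → factor? v w) P) (filter⁺ (λ v → factor? v w) uniq)
    λ v∈ → let v∈P , fv = ∈-filter⁻ (λ v → factor? v w) v∈ in proj₁ (pf v∈P) , fv))
  where
  same : ∀ {p q} → p ∈ P → q ∈ P → ¬ IsFinFactor p w → ¬ IsFinFactor q w → p ≡ q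
  same p∈ q∈ ¬p ¬q
    with palp , fp ← pf p∈ | palq , fq ← pf q∈
    with prefix-or-factor-tail fp | prefix-or-factor-tail fq
  ... | inj₂ f | _ = contradiction f ¬p
  ... | _ | inj₂ f = contradiction f ¬q
  ... | inj₁ ep | inj₁ eq with palPrefix-factor-tail a w _ _ palp palq ep eq
  ...   | inj₁ e = e
  ...   | inj₂ (inj₁ f) = contradiction f ¬p
  ...   | inj₂ (inj₂ f) = contradiction f ¬q

-- If every listed palindrome occurred in `w`, there would be at most `suc (length w)` of them, one
-- too few. A palindrome missing from `w` is a prefix of `a ∷ w` and occurs only there.
rich⇒oncePalPrefix : (w : Word k) → RichFin w → OncePalPrefix w
rich⇒oncePalPrefix [] _ = [] , ([] , refl) , refl , λ _ _ _ ()
rich⇒oncePalPrefix (a ∷ w) (P , uniq , pals , len)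
  with all? (λ v → factor? v w) P
... | yes all = contradiction (palFactors-bound w P uniq λ v∈ →
    proj₁ (Equivalence.to (pals _) v∈) , All.lookup all v∈)
  (λ le → 1+n≰n (≤-trans (≤-reflexive (sym len)) le))
... | no ¬all with p , p∈ , ¬f ← find (¬All⇒Any¬ (λ v → factor? v w) P ¬all)
  with palp , fp ← Equivalence.to (pals p) p∈
  with prefix-or-factor-tail fp
... | inj₂ f = contradiction f ¬f
... | inj₁ e = p , e , palp , λ c s r eq → ¬f (s , r , ∷-injectiveʳ eq)

-- For each nonempty suffix, the palindromic prefix occurring once is the one palindrome that the
-- tail lacks, so the list gains one entry per letter.
oncePalPrefix⇒rich : (w : Word k) → (∀ x v → w ≡ x ++ v → OncePalPrefix v) → RichFin w
oncePalPrefix⇒rich [] _ = [ [] ] , [] ∷ [] ,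
  (λ v → mk⇔ (λ { (here refl) → refl , [] , [] , refl })
    λ { (_ , [] , y , e) → here (empty v e) }) , refl
  where
  empty : ∀ v {y} → [] ≡ v ++ y → v ≡ []
  empty [] _ = refl
oncePalPrefix⇒rich (a ∷ w) once
  with P , uniq , pals , len ← oncePalPrefix⇒rich w (λ x v eq → once (a ∷ x) v (cong (a ∷_) eq))
  with p , ep , palp , once-p ← once [] (a ∷ w) refl =
  p ∷ P , All.tabulate (λ { q∈ refl → p∉P q∈ }) ∷ uniq , (λ v → mk⇔ (to v) (from v)) , cong suc len
  where
  ¬fp : ¬ IsFinFactor p w
  ¬fp (s , r , eq) = once-p a s r (cong (a ∷_) eq)
  p∉P : ¬ p ∈ P
  p∉P p∈ = ¬fp (proj₂ (Equivalence.to (pals p) p∈))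
  to : ∀ v → v ∈ p ∷ P → IsPalindrome v × IsFinFactor v (a ∷ w)
  to v (here refl) = palp , [] , ep
  to v (there v∈) with palv , x , y , eq ← Equivalence.to (pals v) v∈ =
    palv , a ∷ x , y , cong (a ∷_) eq
  from : ∀ v → IsPalindrome v × IsFinFactor v (a ∷ w) → v ∈ p ∷ P
  from v (palv , fv) with prefix-or-factor-tail fv
  ... | inj₂ f = there (Equivalence.from (pals v) (palv , f))
  ... | inj₁ ev with palPrefix-factor-tail a w p v palp palv ep ev
  ...   | inj₁ refl = here refl
  ...   | inj₂ (inj₁ f) = contradiction f ¬fp
  ...   | inj₂ (inj₂ f) = there (Equivalence.from (pals v) (palv , f))

-- Substitution by a separating letter

tl : Fin k → Fin k → Word k
tl x y with y ≟ x
... | yes _ = []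
... | no _ = [ y ]

-- ψ x maps x to x and every other letter y to xy; Ψ x w is ψ x w followed by x, and τ x w is
-- Ψ x w without its first letter.
ψ : Fin k → Word k → Word k
ψ x [] = []
ψ x (y ∷ w) = x ∷ tl x y ++ ψ x w

τ : Fin k → Word k → Word k
τ x [] = []
τ x (y ∷ w) = tl x y ++ x ∷ τ x w

Ψ : Fin k → Word k → Word k
Ψ x w = x ∷ τ x w

tl-cases : (x y : Fin k) → (y ≡ x × tl x y ≡ []) ⊎ (y ≢ x × tl x y ≡ [ y ])
tl-cases x y with y ≟ x
... | yes eq = inj₁ (eq , refl)
... | no neq = inj₂ (neq , refl)

tl-≡ : (x : Fin k) → tl x x ≡ []
tl-≡ x with tl-cases x x
... | inj₁ (_ , e) = e
... | inj₂ (x≢x , _) = contradiction refl x≢x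

tl-≢ : {x y : Fin k} → y ≢ x → tl x y ≡ [ y ]
tl-≢ {x = x} {y} y≢x with tl-cases x y
... | inj₁ (e , _) = contradiction e y≢x
... | inj₂ (_ , e) = e

reverse-tl : (x y : Fin k) → reverse (tl x y) ≡ tl x y
reverse-tl x y with y ≟ x
... | yes _ = refl
... | no _ = refl

Ψ-++ : (x : Fin k) (u v : Word k) → Ψ x (u ++ v) ≡ ψ x u ++ Ψ x v
Ψ-++ x [] v = refl
Ψ-++ x (y ∷ u) v = cong (x ∷_) (trans (cong (tl x y ++_) (Ψ-++ x u v)) (sym (++-assoc (tl x y) _ _)))

Ψ-ψ : (x : Fin k) (u : Word k) → Ψ x u ≡ ψ x u ++ [ x ]
Ψ-ψ x u = trans (cong (Ψ x) (sym (++-identityʳ u))) (Ψ-++ x u [])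

Ψ-++′ : (x : Fin k) (u v : Word k) → Ψ x (u ++ v) ≡ Ψ x u ++ τ x v
Ψ-++′ x u v = trans (Ψ-++ x u v)
  (trans (sym (++-assoc (ψ x u) [ x ] (τ x v))) (cong (_++ τ x v) (sym (Ψ-ψ x u))))

Ψ-∷ʳ-≡ : (x : Fin k) (u : Word k) → Ψ x (u ++ [ x ]) ≡ Ψ x u ++ [ x ]
Ψ-∷ʳ-≡ x u = trans (Ψ-++′ x u [ x ]) (cong (λ t → Ψ x u ++ t ++ [ x ]) (tl-≡ x))

Ψ-∷ʳ-≢ : {x y : Fin k} (u : Word k) → y ≢ x → Ψ x (u ++ [ y ]) ≡ Ψ x u ++ y ∷ x ∷ []
Ψ-∷ʳ-≢ {x = x} u y≢x = trans (Ψ-++′ x u _) (cong (λ t → Ψ x u ++ t ++ [ x ]) (tl-≢ y≢x))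

-- The closing `x` makes images symmetric: each letter other than `x` has an `x` on both sides. This
-- is why `Ψ`, and not `ψ`, defines the derived language.
reverse-Ψ : (x : Fin k) (w : Word k) → reverse (Ψ x w) ≡ Ψ x (reverse w)
reverse-Ψ x [] = refl
reverse-Ψ x (y ∷ w) = begin
  reverse (x ∷ tl x y ++ Ψ x w)               ≡⟨ unfold-reverse x (tl x y ++ Ψ x w) ⟩
  reverse (tl x y ++ Ψ x w) ++ [ x ]          ≡⟨ cong (_++ [ x ]) (reverse-++ (tl x y) (Ψ x w)) ⟩
  (reverse (Ψ x w) ++ reverse (tl x y)) ++ [ x ] ≡⟨ ++-assoc (reverse (Ψ x w)) _ _ ⟩
  reverse (Ψ x w) ++ reverse (tl x y) ++ [ x ] ≡⟨ cong₂ (λ u t → u ++ t ++ [ x ]) (reverse-Ψ x w) (reverse-tl x y) ⟩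
  Ψ x (reverse w) ++ tl x y ++ [ x ]          ≡⟨ Ψ-++′ x (reverse w) [ y ] ⟨
  Ψ x (reverse w ++ [ y ])                    ≡⟨ cong (Ψ x) (unfold-reverse y w) ⟨
  Ψ x (reverse (y ∷ w))                       ∎
  where open ≡-Reasoning

-- Here `e` stands for the remainder of an unfinished last block: empty, or one letter other than
-- `x`.
NotIn : Fin k → Word k → Set
NotIn x e = ∀ q s → e ≢ q ++ x ∷ s

notIn-[] : {x : Fin k} → NotIn x []
notIn-[] [] _ ()
notIn-[] (_ ∷ _) _ ()

notIn-[y] : {x y : Fin k} → y ≢ x → NotIn x [ y ]
notIn-[y] y≢x [] _ refl = y≢x refl
notIn-[y] y≢x (_ ∷ []) _ ()
notIn-[y] y≢x (_ ∷ _ ∷ _) _ ()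

-- Every occurrence of x in Ψ x w begins a block, which makes decoding unambiguous.
Ψ-split-at-x : {x : Fin k} {e : Word k} → NotIn x e → (w q : Word k) {s : Word k} →
  Ψ x w ++ e ≡ q ++ x ∷ s → ∃₂ λ u v → w ≡ u ++ v × q ≡ ψ x u × x ∷ s ≡ Ψ x v ++ e
Ψ-split-at-x x∉e w [] eq = [] , w , refl , refl , sym eq
Ψ-split-at-x x∉e [] (_ ∷ q) eq = contradiction (∷-injectiveʳ eq) (x∉e q _)
Ψ-split-at-x {x = x} {e} x∉e (y ∷ w) (_ ∷ q) eq
  with refl , eq′ ← ∷-injective eq
  with tl-cases x y
... | inj₁ (refl , te)
  with u , v , refl , refl , es ← Ψ-split-at-x x∉e w q (subst (λ t → (t ++ Ψ x w) ++ e ≡ q ++ x ∷ _) te eq′) =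
  x ∷ u , v , refl , cong (λ t → x ∷ t ++ ψ x u) (sym te) , es
... | inj₂ (y≢x , te) = go q (subst (λ t → (t ++ Ψ x w) ++ e ≡ q ++ x ∷ _) te eq′)
  where
  go : ∀ q {s} → y ∷ Ψ x w ++ e ≡ q ++ x ∷ s →
    ∃₂ λ u v → y ∷ w ≡ u ++ v × x ∷ q ≡ ψ x u × x ∷ s ≡ Ψ x v ++ e
  go [] eq = contradiction (∷-injectiveˡ eq) y≢x
  go (_ ∷ q) eq with refl , eq′ ← ∷-injective eq
    with u , v , refl , refl , es ← Ψ-split-at-x x∉e w q eq′ =
    y ∷ u , v , refl , cong (λ t → x ∷ t ++ ψ x u) (sym te) , es

-- In an image, a letter other than `x` stands between two `x`, so cutting it out leaves a complete
-- image on each side.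
Ψ-split-at-other : {x z : Fin k} → z ≢ x → (w s : Word k) {t : Word k} →
  Ψ x w ≡ s ++ z ∷ t → ∃₂ λ u v → s ≡ Ψ x u × t ≡ Ψ x v
Ψ-split-at-other z≢x w [] eq = contradiction (sym (∷-injectiveˡ eq)) z≢x
Ψ-split-at-other z≢x [] (_ ∷ []) ()
Ψ-split-at-other z≢x [] (_ ∷ _ ∷ _) ()
Ψ-split-at-other {x = x} {z} z≢x (y ∷ w) (_ ∷ s) eq
  with refl , eq′ ← ∷-injective eq
  with tl-cases x y
... | inj₁ (refl , te)
  with u , v , refl , refl ← Ψ-split-at-other z≢x w s (subst (λ t → t ++ Ψ x w ≡ s ++ z ∷ _) te eq′) =
  x ∷ u , v , cong (λ t → x ∷ t ++ Ψ x u) (sym te) , refl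
... | inj₂ (y≢x , te) = go s (subst (λ t → t ++ Ψ x w ≡ s ++ z ∷ _) te eq′)
  where
  go : ∀ s {t} → y ∷ Ψ x w ≡ s ++ z ∷ t → ∃₂ λ u v → x ∷ s ≡ Ψ x u × t ≡ Ψ x v
  go [] eq = [] , w , refl , sym (∷-injectiveʳ eq)
  go (_ ∷ s) eq with refl , eq′ ← ∷-injective eq
    with u , v , refl , refl ← Ψ-split-at-other z≢x w s eq′ =
    y ∷ u , v , cong (λ t → x ∷ t ++ Ψ x u) (sym te) , refl

-- Blocks are compared one by one: the letter after the opening `x` is the letter that the block
-- encodes, be it `x` or another.
Ψ-prefix : {x : Fin k} {e : Word k} → NotIn x e → (p q : Word k) {r : Word k} →
  Ψ x q ++ e ≡ Ψ x p ++ r → ∃ λ r′ → q ≡ p ++ r′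
Ψ-prefix x∉e [] q _ = q , refl
Ψ-prefix {x = x} x∉e (y ∷ p) [] {r} eq = contradiction
  (trans (∷-injectiveʳ eq) (++-assoc (tl x y) (Ψ x p) r)) (x∉e (tl x y) _)
Ψ-prefix {x = x} {e} x∉e (y ∷ p) (z ∷ q) {r} eq
  with eq′ ← ∷-injectiveʳ eq
  with tl x y | tl x z | tl-cases x y | tl-cases x z
... | _ | _ | inj₁ (refl , refl) | inj₁ (refl , refl)
  with r′ , refl ← Ψ-prefix x∉e p q eq′ = r′ , refl
... | _ | _ | inj₁ (refl , refl) | inj₂ (z≢x , refl) = contradiction (∷-injectiveˡ eq′) z≢x
... | _ | _ | inj₂ (y≢x , refl) | inj₁ (refl , refl) = contradiction (sym (∷-injectiveˡ eq′)) y≢x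
... | _ | _ | inj₂ (_ , refl) | inj₂ (_ , refl)
  with refl , eq″ ← ∷-injective eq′
  with r′ , refl ← Ψ-prefix x∉e p q eq″ = r′ , refl

τ-≢[] : (x y : Fin k) (w : Word k) → τ x (y ∷ w) ≢ []
τ-≢[] x y w eq with tl x y
τ-≢[] x y w () | []
τ-≢[] x y w () | _ ∷ _

Ψ-injective : (x : Fin k) {u v : Word k} → Ψ x u ≡ Ψ x v → u ≡ v
Ψ-injective x {u} {v} eq
  with Ψ-prefix notIn-[] v u (cong (_++ []) eq)
... | [] , e = trans e (++-identityʳ v)
... | c ∷ r , refl = contradiction
  (++-cancelˡ (Ψ x v) _ _ (trans (sym (Ψ-++′ x v (c ∷ r))) (trans eq (sym (++-identityʳ (Ψ x v))))))
  (τ-≢[] x c r)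

Ψ-suffix : {x : Fin k} (w s v : Word k) → Ψ x w ≡ s ++ Ψ x v → ∃ λ u → w ≡ u ++ v
Ψ-suffix {x = x} w s v eq
  with u , v′ , e , _ , ev ← Ψ-split-at-x notIn-[] w s (trans (++-identityʳ (Ψ x w)) eq)
  with refl ← Ψ-injective x {v} {v′} (trans ev (++-identityʳ _)) = u , e

Ψ-palindrome : (x : Fin k) {w : Word k} → IsPalindrome (Ψ x w) → IsPalindrome w
Ψ-palindrome x {w} pal = Ψ-injective x (trans (sym (reverse-Ψ x w)) pal)

palindrome-Ψ : (x : Fin k) {w : Word k} → IsPalindrome w → IsPalindrome (Ψ x w)
palindrome-Ψ x {w} pal = trans (reverse-Ψ x w) (cong (Ψ x) pal)

length<Ψ : (x : Fin k) (w : Word k) → length w < length (Ψ x w)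
length<Ψ x [] = s≤s z≤n
length<Ψ x (y ∷ w) = s≤s (≤-trans (length<Ψ x w)
  (≤-trans (m≤n+m _ (length (tl x y))) (≤-reflexive (sym (length-++ (tl x y))))))

-- Letter counts

count-++ : (a : Fin k) (u v : Word k) → count a (u ++ v) ≡ count a u + count a v
count-++ a u v = trans (cong length (filter-++ (_≟ a) u v)) (length-++ (filter (_≟ a) u))

count-≡ : (a : Fin k) (w : Word k) → count a (a ∷ w) ≡ suc (count a w)
count-≡ a w = cong length (filter-accept (_≟ a) {xs = w} refl)

count-≢ : {a b : Fin k} (w : Word k) → b ≢ a → count a (b ∷ w) ≡ count a w
count-≢ {a = a} w b≢a = cong length (filter-reject (_≟ a) {xs = w} b≢a)

count-tl-x : (x y : Fin k) → count x (tl x y) ≡ 0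
count-tl-x x y with tl x y | tl-cases x y
... | _ | inj₁ (_ , refl) = refl
... | _ | inj₂ (y≢x , refl) = count-≢ [] y≢x

count-tl-other : {x a : Fin k} → a ≢ x → (y : Fin k) → count a (tl x y) ≡ count a [ y ]
count-tl-other {x = x} a≢x y with tl x y | tl-cases x y
... | _ | inj₁ (refl , refl) = sym (count-≢ [] (a≢x ∘ sym))
... | _ | inj₂ (_ , refl) = refl

length-tl : (x y : Fin k) → length (tl x y) + count x [ y ] ≡ 1
length-tl x y with tl x y | tl-cases x y
... | _ | inj₁ (refl , refl) = count-≡ x []
... | _ | inj₂ (y≢x , refl) = cong suc (count-≢ [] y≢x)

count-x-Ψ : (x : Fin k) (w : Word k) → count x (Ψ x w) ≡ suc (length w)
count-x-Ψ x [] = count-≡ x []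
count-x-Ψ x (y ∷ w) = trans (count-≡ x (τ x (y ∷ w)))
  (cong suc (trans (count-++ x (tl x y) (Ψ x w)) (cong₂ _+_ (count-tl-x x y) (count-x-Ψ x w))))

count-other-Ψ : {x a : Fin k} → a ≢ x → (w : Word k) → count a (Ψ x w) ≡ count a w
count-other-Ψ a≢x [] = count-≢ [] (a≢x ∘ sym)
count-other-Ψ {x = x} {a} a≢x (y ∷ w) = begin
  count a (Ψ x (y ∷ w))              ≡⟨ count-≢ _ (a≢x ∘ sym) ⟩
  count a (tl x y ++ Ψ x w)          ≡⟨ count-++ a (tl x y) (Ψ x w) ⟩
  count a (tl x y) + count a (Ψ x w) ≡⟨ cong₂ _+_ (count-tl-other a≢x y) (count-other-Ψ a≢x w) ⟩
  count a [ y ] + count a w          ≡⟨ count-++ a [ y ] w ⟨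
  count a (y ∷ w)                    ∎
  where open ≡-Reasoning

-- A block has length 2, except that of `x`, which has length 1; adding `count x w` evens this out
-- and avoids subtraction.
length-Ψ : (x : Fin k) (w : Word k) → length (Ψ x w) + count x w ≡ suc (length w + length w)
length-Ψ x [] = refl
length-Ψ x (y ∷ w) = cong suc (begin
  length (tl x y ++ Ψ x w) + count x (y ∷ w)
    ≡⟨ cong₂ _+_ (length-++ (tl x y)) (count-++ x [ y ] w) ⟩
  (length (tl x y) + length (Ψ x w)) + (count x [ y ] + count x w)
    ≡⟨ interchange (length (tl x y)) _ _ _ ⟩
  (length (tl x y) + count x [ y ]) + (length (Ψ x w) + count x w)
    ≡⟨ cong₂ _+_ (length-tl x y) (length-Ψ x w) ⟩
  suc (suc (length w + length w))
    ≡⟨ cong suc (+-suc (length w) (length w)) ⟨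
  suc (length w + suc (length w)) ∎)
  where open ≡-Reasoning

Ψ-strip : (x y : Fin k) (w : Word k) → ∃ λ v → Ψ x (y ∷ w) ≡ x ∷ v ++ [ x ]
Ψ-strip x y w = tl x y ++ ψ x w ,
  cong (x ∷_) (trans (cong (tl x y ++_) (Ψ-ψ x w)) (sym (++-assoc (tl x y) _ _)))

-- Languages

RSpecial : (Word k → Set) → Word k → Set
RSpecial {k} L u = ∃ λ (a : Fin k) → ∃ λ b → a ≢ b × L (u ++ [ a ]) × L (u ++ [ b ])

UniqueRSpecial : (Word k → Set) → Set
UniqueRSpecial L = ∀ u v → length u ≡ length v → RSpecial L u → RSpecial L v → u ≡ v

Bal : (Word k → Set) → Set
Bal L = ∀ u v → L u → L v → length u ≡ length v → ∀ a → count a u ≤ suc (count a v)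

OncePal : (Word k → Set) → Set
OncePal L = ∀ w → L w → OncePalPrefix w

-- `joined` takes over the role of recurrence: it speaks of words only and passes to the derived
-- language.
record Language (L : Word k → Set) : Set where
  field
    factor  : ∀ u v w → L (u ++ v ++ w) → L v
    reversed : ∀ u → L u → L (reverse u)
    joined  : ∀ u v → L u → L v → ∃ λ m → L (u ++ m ++ v)

  prefix : ∀ u w → L (u ++ w) → L u
  prefix u w = factor [] u w

  suffix : ∀ u v → L (u ++ v) → L v
  suffix u v l = factor u v [] (subst (λ v → L (u ++ v)) (sym (++-identityʳ v)) l)

  extendˡ : ∀ a u → L (a ∷ u) → ∃ λ e → L (e ∷ a ∷ u)
  extendˡ a u l with m , lm ← joined (a ∷ u) (a ∷ u) l l
    with s , e , eq ← snoc-view a (u ++ m) =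
    e , suffix s (e ∷ a ∷ u) (subst L (begin
      (a ∷ u) ++ m ++ a ∷ u  ≡⟨ ++-assoc (a ∷ u) m (a ∷ u) ⟨
      (a ∷ u ++ m) ++ a ∷ u  ≡⟨ cong (_++ a ∷ u) eq ⟩
      (s ++ [ e ]) ++ a ∷ u  ≡⟨ ++-assoc s [ e ] (a ∷ u) ⟩
      s ++ e ∷ a ∷ u         ∎) lm)
    where open ≡-Reasoning

  extendʳ : ∀ u a → L (u ++ [ a ]) → ∃ λ e → L (u ++ a ∷ e ∷ [])
  extendʳ u a l
    with e , le ← extendˡ a (reverse u) (subst L (reverse-++ u [ a ]) (reversed _ l)) =
    e , subst L (begin
      reverse (e ∷ a ∷ reverse u)              ≡⟨ reverse-++ (e ∷ a ∷ []) (reverse u) ⟩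
      reverse (reverse u) ++ a ∷ e ∷ []        ≡⟨ cong (_++ a ∷ e ∷ []) (reverse-involutive u) ⟩
      u ++ a ∷ e ∷ []                          ∎) (reversed _ le)
    where open ≡-Reasoning

  special-factor : ∀ {u} → RSpecial L u → L u
  special-factor (_ , _ , _ , l , _) = prefix _ _ l

  special-suffix : ∀ s u → RSpecial L (s ++ u) → RSpecial L u
  special-suffix s u (a , b , a≢b , la , lb) =
    a , b , a≢b , suffix s _ (subst L (++-assoc s u [ a ]) la) , suffix s _ (subst L (++-assoc s u [ b ]) lb)

-- Hubs and the derived language

Hub : Fin k → (Word k → Set) → Set
Hub x L = ∀ a b → L (a ∷ b ∷ []) → a ≢ x → b ≡ x

Derived : Fin k → (Word k → Set) → Word k → Set
Derived x L w = L (Ψ x w)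

module _ {L : Word k → Set} (lang : Language L) where
  open Language lang

  -- Two adjacent letters a, b ≠ x that are not right special force an endless abab…, so x is
  -- never reached from them.
  unique-special-letter⇒hub : ∀ x → L [ x ] → (∀ a → a ≢ x → ¬ RSpecial L [ a ]) → Hub x L
  unique-special-letter⇒hub x lx ns a b lab a≢x with b ≟ x
  ... | yes b≡x = b≡x
  ... | no b≢x with m , lm ← joined [ a ] [ x ] (prefix [ a ] [ b ] lab) lx =
    ⊥-elim (alternate m a b a≢x b≢x lab (reversed _ lab) lm)
    where
    next : ∀ a b c → a ≢ x → L (a ∷ b ∷ []) → L (a ∷ c ∷ []) → c ≡ b
    next a b c a≢x lab lac =
      decidable-stable (c ≟ b) λ c≢b → ns a a≢x (c , b , c≢b , lac , lab)
    alternate : ∀ m c d → c ≢ x → d ≢ x → L (c ∷ d ∷ []) → L (d ∷ c ∷ []) → L (c ∷ m ++ [ x ]) → ⊥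
    alternate [] c d c≢x d≢x lcd ldc lm = d≢x (sym (next c d x c≢x lcd lm))
    alternate (e ∷ m) c d c≢x d≢x lcd ldc lm
      with refl ← next c d e c≢x lcd (prefix (c ∷ e ∷ []) _ lm) =
      alternate m d c d≢x c≢x ldc lcd (suffix [ c ] _ lm)

  module _ {x : Fin k} (hub : Hub x L) where

    hub-left : ∀ a u → L (a ∷ u) → a ≢ x → L (x ∷ a ∷ u)
    hub-left a u l a≢x with e , le ← extendˡ a u l with e ≟ x
    ... | yes refl = le
    ... | no e≢x = contradiction (hub e a (prefix (e ∷ a ∷ []) u le) e≢x) a≢x

    hub-right : ∀ u a → L (u ++ [ a ]) → a ≢ x → L (u ++ a ∷ x ∷ [])
    hub-right u a l a≢x with e , le ← extendʳ u a l
      with refl ← hub a e (suffix u _ le) a≢x = le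

    lift-right : ∀ u v c → L (u ++ Ψ x v ++ [ c ]) → L (u ++ Ψ x (v ++ [ c ]))
    lift-right u v c l with c ≟ x
    ... | yes refl = subst (λ w → L (u ++ w)) (sym (Ψ-∷ʳ-≡ x v)) l
    ... | no c≢x = subst L
      (trans (++-assoc u (Ψ x v) _) (cong (u ++_) (sym (Ψ-∷ʳ-≢ v c≢x))))
      (hub-right (u ++ Ψ x v) c (subst L (sym (++-assoc u (Ψ x v) [ c ])) l) c≢x)

    lift-left : ∀ a v → L (a ∷ Ψ x v) → L (Ψ x (a ∷ v))
    lift-left a v l with tl x a | tl-cases x a
    ... | _ | inj₁ (refl , refl) = l
    ... | _ | inj₂ (a≢x , refl) = hub-left a _ l a≢x

    -- Letters other than `x` are isolated, so the word splits into blocks; only the last block can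
    -- be cut, leaving its letter `y` without the closing `x`.
    decode : ∀ w → L (x ∷ w) → ∃ λ v → (x ∷ w ≡ Ψ x v) ⊎ (∃ λ y → y ≢ x × x ∷ w ≡ Ψ x v ++ [ y ])
    decode [] _ = [] , inj₁ refl
    decode (y ∷ w) l with y ≟ x
    decode (y ∷ w) l | yes refl with decode w (suffix [ x ] _ l)
    ... | v , inj₁ e = x ∷ v , inj₁ (cong (x ∷_) (trans e (cong (_++ Ψ x v) (sym (tl-≡ x)))))
    ... | v , inj₂ (y , y≢x , e) = x ∷ v , inj₂ (y , y≢x ,
      cong (x ∷_) (trans e (cong (λ t → (t ++ Ψ x v) ++ [ y ]) (sym (tl-≡ x)))))
    decode (y ∷ []) l | no y≢x = [] , inj₂ (y , y≢x , refl)
    decode (y ∷ z ∷ w) l | no y≢x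
      with refl ← hub y z (factor [ x ] (y ∷ z ∷ []) w l) y≢x
      with decode w (suffix (x ∷ y ∷ []) _ l)
    ... | v , inj₁ e = y ∷ v , inj₁ (cong (x ∷_)
      (trans (cong (y ∷_) e) (cong (_++ Ψ x v) (sym (tl-≢ y≢x)))))
    ... | v , inj₂ (c , c≢x , e) = y ∷ v , inj₂ (c , c≢x , cong (x ∷_)
      (trans (cong (y ∷_) e) (cong (λ t → (t ++ Ψ x v) ++ [ c ]) (sym (tl-≢ y≢x)))))

    decode-closed : ∀ w s → L (x ∷ w) → x ∷ w ≡ s ++ [ x ] → ∃ λ v → x ∷ w ≡ Ψ x v
    decode-closed w s l eq with decode w l
    ... | v , inj₁ e = v , e
    ... | v , inj₂ (y , y≢x , e) =
      contradiction (∷ʳ-injectiveʳ (Ψ x v) s (trans (sym e) eq)) y≢x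

    derived-language : Language (Derived x L)
    derived-language = record
      { factor = λ u v w l → prefix (Ψ x v) (τ x w) (subst L (Ψ-++′ x v w)
          (suffix (ψ x u) _ (subst L (Ψ-++ x u (v ++ w)) l)))
      ; reversed = λ u l → subst L (reverse-Ψ x u) (reversed _ l)
      ; joined = join }
      where
      join : ∀ u v → L (Ψ x u) → L (Ψ x v) → ∃ λ m → L (Ψ x (u ++ m ++ v))
      join u v lu lv with m , lm ← joined (Ψ x u) (Ψ x v) lu lv
        with lm′ ← subst L (trans (cong (_++ m ++ Ψ x v) (Ψ-ψ x u))
          (trans (++-assoc (ψ x u) [ x ] _)
          (cong (λ w → ψ x u ++ x ∷ w) (sym (++-assoc m [ x ] (τ x v)))))) lm
        -- From the last `x` of `Ψ x u` to the first `x` of `Ψ x v`, the word begins and ends with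
        -- `x`, so it is the image of a joining word.
        with q , eq ← decode-closed (m ++ [ x ]) (x ∷ m)
          (factor (ψ x u) (x ∷ m ++ [ x ]) (τ x v) lm′) refl =
        q , subst L (begin
          ψ x u ++ (x ∷ m ++ [ x ]) ++ τ x v ≡⟨ cong (λ w → ψ x u ++ w ++ τ x v) eq ⟩
          ψ x u ++ Ψ x q ++ τ x v            ≡⟨ cong (ψ x u ++_) (Ψ-++′ x q v) ⟨
          ψ x u ++ Ψ x (q ++ v)              ≡⟨ Ψ-++ x u (q ++ v) ⟨
          Ψ x (u ++ q ++ v)                  ∎) lm′
        where open ≡-Reasoning

    derived-special : ∀ u → RSpecial (Derived x L) u → RSpecial L (Ψ x u)
    derived-special u (a , b , a≢b , la , lb) = a , b , a≢b , trim a la , trim b lb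
      where
      trim : ∀ c → L (Ψ x (u ++ [ c ])) → L (Ψ x u ++ [ c ])
      trim c l with c ≟ x
      ... | yes refl = subst L (Ψ-∷ʳ-≡ x u) l
      ... | no c≢x = prefix _ [ x ] (subst L (trans (Ψ-∷ʳ-≢ u c≢x) (sym (++-assoc (Ψ x u) [ c ] [ x ]))) l)

    special-derived : ∀ a u → RSpecial L (a ∷ Ψ x u) → RSpecial (Derived x L) (a ∷ u)
    special-derived a u (c , d , c≢d , lc , ld) = c , d , c≢d ,
      lift-left a (u ++ [ c ]) (lift-right [ a ] u c lc) , lift-left a (u ++ [ d ]) (lift-right [ a ] u d ld)

-- Balance and palindromic prefixes in the derived language

window : {L : Word k → Set} → Language L → Bal L → ∀ u v → L u → L v → length u ≤ length v →
  ∀ a → count a u ≤ suc (count a v)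
window {L = L} lang bal u v lu lv le a = ≤-trans
  (bal u (take n v) lu (prefix _ (drop n v) (subst L (sym (take++drop≡id n v)) lv))
    (sym (trans (length-take n v) (m≤n⇒m⊓n≡m le))) a)
  (s≤s (≤-trans (m≤m+n _ _) (≤-reflexive
    (trans (sym (count-++ a (take n v) (drop n v))) (cong (count a) (take++drop≡id n v))))))
  where
  open Language lang
  n = length u

length-strip : (x : Fin k) (v : Word k) → length (x ∷ v ++ [ x ]) ≡ 2 + length v
length-strip x v = cong suc (trans (length-++ v) (+-comm (length v) 1))

palindrome-last : (a : Fin k) (p q : Word k) (e : Fin k) → IsPalindrome (a ∷ p) → a ∷ p ≡ q ++ [ e ] → e ≡ a
palindrome-last a p q e pal eq = ∷-injectiveˡ
  (trans (sym (reverse-++ q [ e ])) (trans (cong reverse (sym eq)) pal))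

module _ {L : Word k → Set} (lang : Language L) (x : Fin k) where
  open Language lang

  -- Both sides equal twice the common length plus 1. Thus the lengths of a stripped and a full
  -- image compare through the counts of `x`.
  strip-measure : ∀ u v {U} → length u ≡ length v → Ψ x u ≡ x ∷ U ++ [ x ] →
    length U + (2 + count x u) ≡ length (Ψ x v) + count x v
  strip-measure u v {U} len eU = begin
    length U + (2 + count x u)   ≡⟨ +-assoc (length U) 2 (count x u) ⟨
    length U + 2 + count x u     ≡⟨ cong (_+ count x u) (+-comm (length U) 2) ⟩
    2 + length U + count x u     ≡⟨ cong (_+ count x u) (trans (cong length eU) (length-strip x U)) ⟨
    length (Ψ x u) + count x u   ≡⟨ length-Ψ x u ⟩
    suc (length u + length u)    ≡⟨ cong (λ n → suc (n + n)) len ⟩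
    suc (length v + length v)    ≡⟨ length-Ψ x v ⟨
    length (Ψ x v) + count x v   ∎
    where open ≡-Reasoning

  strip-factor : ∀ u {U} → L (Ψ x u) → Ψ x u ≡ x ∷ U ++ [ x ] → L U
  strip-factor _ {U} l eU = factor [ x ] U [ x ] (subst L eU l)

  -- The first and last letter of the image of v are x, so stripping them leaves a word that is
  -- poor in x but still at least as long as the image of u.
  derived-balanced-x : Bal L → ∀ u d v → L (Ψ x u) → L (Ψ x (d ∷ v)) → length u ≡ suc (length v) →
    count x u ≤ suc (count x (d ∷ v))
  derived-balanced-x bal u d v₁ lu lv len
    with V , eV ← Ψ-strip x d v₁ = decidable-stable (count x u ≤? suc (count x v)) λ ¬le →
      -- The image of `u` has `suc (length v)` letters `x`, while `V` has `length v ∸ 1`: a gap of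
      -- two.
      1+n≰n (≤-trans (≤-reflexive (trans (cong suc (countV V eV)) (trans (cong suc (sym len)) (sym (count-x-Ψ x u)))))
        (window lang bal (Ψ x u) V lu (strip-factor v lv eV) (shorter V eV (≰⇒> ¬le)) x))
    where
    v = d ∷ v₁
    open ≤-Reasoning
    shorter : ∀ V → Ψ x v ≡ x ∷ V ++ [ x ] → 2 + count x v ≤ count x u → length (Ψ x u) ≤ length V
    shorter V eV big = +-cancelʳ-≤ (2 + count x v) _ _ (begin
      length (Ψ x u) + (2 + count x v) ≤⟨ +-monoʳ-≤ (length (Ψ x u)) big ⟩
      length (Ψ x u) + count x u       ≡⟨ strip-measure v u (sym len) eV ⟨
      length V + (2 + count x v)       ∎)
    countV : ∀ V → Ψ x v ≡ x ∷ V ++ [ x ] → suc (count x V) ≡ length v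
    countV V eV = suc-injective (begin-equality
      2 + count x V             ≡⟨ cong suc (+-comm 1 (count x V)) ⟩
      suc (count x V + 1)       ≡⟨ cong (λ n → suc (count x V + n)) (count-≡ x []) ⟨
      suc (count x V + count x [ x ]) ≡⟨ cong suc (count-++ x V [ x ]) ⟨
      suc (count x (V ++ [ x ])) ≡⟨ count-≡ x (V ++ [ x ]) ⟨
      count x (x ∷ V ++ [ x ])  ≡⟨ cong (count x) eV ⟨
      count x (Ψ x v)           ≡⟨ count-x-Ψ x v ⟩
      suc (length v)            ∎)

  derived-balanced : Bal L → Bal (Derived x L)
  derived-balanced bal [] [] _ _ _ _ = z≤n
  derived-balanced bal u@(c ∷ u₁) v@(d ∷ v₁) lu lv len a with a ≟ x
  ... | yes refl = derived-balanced-x bal u d v₁ lu lv len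
  -- `Ψ x` preserves the count of `a`, and so does stripping the two `x`. The stripped image of `u`
  -- is no longer than the full image of `v`, by the case of `x` with the words exchanged.
  ... | no a≢x with U , eU ← Ψ-strip x c u₁ = begin
      count a u            ≡⟨ count-other-Ψ a≢x u ⟨
      count a (Ψ x u)      ≡⟨ cong (count a) eU ⟩
      count a (x ∷ U ++ [ x ]) ≡⟨ count-≢ (U ++ [ x ]) (a≢x ∘ sym) ⟩
      count a (U ++ [ x ]) ≡⟨ count-++ a U [ x ] ⟩
      count a U + count a [ x ] ≡⟨ cong (count a U +_) (count-≢ [] (a≢x ∘ sym)) ⟩
      count a U + 0        ≡⟨ +-identityʳ _ ⟩
      count a U            ≤⟨ window lang bal U (Ψ x v) (strip-factor u lu eU) lv (shorter U eU) a ⟩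
      suc (count a (Ψ x v)) ≡⟨ cong suc (count-other-Ψ a≢x v) ⟩
      suc (count a v)      ∎
    where
    open ≤-Reasoning
    shorter : ∀ U → Ψ x u ≡ x ∷ U ++ [ x ] → length U ≤ length (Ψ x v)
    shorter U eU = +-cancelʳ-≤ (2 + count x u) _ _ (begin
      length U + (2 + count x u)      ≡⟨ strip-measure u v len eU ⟩
      length (Ψ x v) + count x v      ≤⟨ +-monoʳ-≤ (length (Ψ x v)) (m≤n⇒m≤1+n (derived-balanced-x bal v c u₁ lv lu (sym len))) ⟩
      length (Ψ x v) + (2 + count x u) ∎)

  -- The palindromic prefix is nonempty, since the empty word recurs; it begins, hence ends, with
  -- `x` and so is the image of a prefix of `w`. A second occurrence of that prefix would give one
  -- of its image.
  derived-oncePal : OncePal L → OncePal (Derived x L)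
  derived-oncePal once w l with once (Ψ x w) l
  ... | [] , _ , _ , o = contradiction (sym (++-identityʳ (Ψ x w))) (o x (τ x w) [])
  ... | a ∷ P , (s , eq) , pal , o
    with refl ← ∷-injectiveˡ eq
    with q , e , eP ← snoc-view x P
    with refl ← palindrome-last x P q e pal eP
    with u , v , refl , refl , _ ← Ψ-split-at-x notIn-[] w q (trans (++-identityʳ (Ψ x w))
      (trans eq (trans (cong (_++ s) eP) (++-assoc q [ x ] s)))) =
    let eP′ = trans eP (sym (Ψ-ψ x u)) in
    u , (v , refl) , Ψ-palindrome x (subst IsPalindrome eP′ pal) , λ c s′ r eq′ →
      o x (tl x c ++ ψ x s′) (τ x r) (begin
        Ψ x (u ++ v)                    ≡⟨ cong (Ψ x) eq′ ⟩
        Ψ x ((c ∷ s′) ++ u ++ r)        ≡⟨ Ψ-++ x (c ∷ s′) (u ++ r) ⟩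
        ψ x (c ∷ s′) ++ Ψ x (u ++ r)    ≡⟨ cong (ψ x (c ∷ s′) ++_) (Ψ-++′ x u r) ⟩
        ψ x (c ∷ s′) ++ Ψ x u ++ τ x r  ≡⟨ cong (λ p → ψ x (c ∷ s′) ++ p ++ τ x r) eP′ ⟨
        ψ x (c ∷ s′) ++ (x ∷ P) ++ τ x r ∎)
    where open ≡-Reasoning

-- Right special letters

zero-count-bound : {L : Word k → Set} → Bal L → ∀ {u v} → L u → L v → length u ≡ length v →
  ∀ a → 2 ≤ count a u → count a v ≢ 0
zero-count-bound bal {u} {v} lu lv len a two zero-v = 1+n≰n
  (≤-trans two (≤-trans (bal u v lu lv len a) (≤-reflexive (cong suc zero-v))))

count-∷-≤ : (a b : Fin k) (w : Word k) → count a w ≤ count a (b ∷ w)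
count-∷-≤ a b w = ≤-trans (m≤n+m _ (count a [ b ])) (≤-reflexive (sym (count-++ a [ b ] w)))

count-ends : (z y : Fin k) → 2 ≤ count z (z ∷ y ∷ z ∷ [])
count-ends z y = ≤-trans (s≤s (≤-trans (≤-reflexive (sym (count-≡ z []))) (count-∷-≤ z y [ z ])))
  (≤-reflexive (sym (count-≡ z (y ∷ [ z ]))))

module _ {L : Word k → Set} (lang : Language L) (bal : Bal L) (once : OncePal L) where
  open Language lang

  module _ {a b : Fin k} (a≢b : a ≢ b) (ra : RSpecial L [ a ]) (rb : RSpecial L [ b ]) where

    -- By balance, a square `z z` forces `z` into every word of length 2. Then a letter other than
    -- `z` is followed by `z` only, so both special letters would be `z`.
    no-square : ∀ z → ¬ L (z ∷ z ∷ [])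
    no-square z lz = a≢b (trans (is-z ra) (sym (is-z rb)))
      where
      meets : ∀ {c d} → L (c ∷ d ∷ []) → c ≢ z → d ≡ z
      meets {c} {d} l c≢z = decidable-stable (d ≟ z) λ d≢z →
        zero-count-bound bal lz l refl z
          (≤-reflexive (sym (trans (count-≡ z [ z ]) (cong suc (count-≡ z [])))))
          (trans (count-≢ [ d ] c≢z) (count-≢ [] d≢z))
      is-z : ∀ {g} → RSpecial L [ g ] → g ≡ z
      is-z {g} (p , q , p≢q , lp , lq) = decidable-stable (g ≟ z) λ g≢z →
        p≢q (trans (meets lp g≢z) (sym (meets lq g≢z)))

    -- In `a m a` the letter `a` recurs, so the palindromic prefix occurring once has length at
    -- least 2. Its centre is no square, hence of the form `z y z`.
    exists-aba : ∃₂ λ z y → L (z ∷ y ∷ z ∷ [])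
    exists-aba
      with la ← special-factor ra
      with m , lm ← joined [ a ] [ a ] la la
      with once _ lm
    ... | [] , _ , _ , o = contradiction (cong (a ∷_) (sym (++-identityʳ (m ++ [ a ])))) (o a (m ++ [ a ]) [])
    ... | c ∷ [] , (s , eq) , _ , o with refl ← ∷-injectiveˡ eq = contradiction refl (o a m [])
    ... | p@(_ ∷ _ ∷ _) , (t , eq) , pal , o
      with palindrome-core (length p) p ≤-refl pal (s≤s (s≤s z≤n))
    ... | s , r , inj₁ (z , e) = contradiction
      (factor s (z ∷ z ∷ []) r (subst L e (prefix p t (subst L eq lm)))) (no-square z)
    ... | s , r , inj₂ (z , y , e) = z , y , factor s (z ∷ y ∷ z ∷ []) r (subst L e (prefix p t (subst L eq lm)))

    -- Balance puts z into every factor of length 3, so a right special letter g ≠ z yields a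
    -- factor z g c z with c ≠ z: a complete return to z which is not a palindrome.
    special-letters-clash : ⊥
    special-letters-clash with z , y , lz ← exists-aba = go
      where
      meets : ∀ {c d e} → L (c ∷ d ∷ e ∷ []) → ¬ (c ≢ z × d ≢ z × e ≢ z)
      meets l (c≢z , d≢z , e≢z) = zero-count-bound bal lz l refl z (count-ends z y)
        (trans (count-≢ _ c≢z) (trans (count-≢ _ d≢z) (count-≢ [] e≢z)))
      return : ∀ g c → g ≢ z → c ≢ z → L (g ∷ c ∷ []) → ⊥
      return g c g≢z c≢z l
        with e , le ← extendˡ g [ c ] l
        with refl ← decidable-stable (e ≟ z) (λ e≢z → meets le (e≢z , g≢z , c≢z))
        with f , lf ← extendʳ (e ∷ g ∷ []) c le
        with refl ← decidable-stable (f ≟ e) (λ f≢z → meets (suffix [ e ] _ lf) (g≢z , c≢z , f≢z))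
        -- In `z g c z` no palindromic prefix occurs once: the empty word and `z` recur, and the
        -- longer prefixes are palindromes only if `g` or `c` is `z` or `g` and `c` agree.
        with once _ lf
      ... | [] , _ , _ , o = o e (g ∷ c ∷ e ∷ []) [] refl
      ... | _ ∷ [] , (_ , refl) , _ , o = o e (g ∷ c ∷ []) [] refl
      ... | _ ∷ _ ∷ [] , (_ , refl) , pal , _ = g≢z (∷-injectiveˡ pal)
      ... | _ ∷ _ ∷ _ ∷ [] , (_ , refl) , pal , _ = c≢z (∷-injectiveˡ pal)
      ... | _ ∷ _ ∷ _ ∷ _ ∷ [] , (_ , refl) , pal , _ =
        no-square g (subst (λ c → L (g ∷ c ∷ [])) (∷-injectiveˡ (∷-injectiveʳ pal)) l)
      special-is-z : ∀ g → RSpecial L [ g ] → g ≡ z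
      special-is-z g (p , q , p≢q , lp , lq) = decidable-stable (g ≟ z) λ g≢z →
        let is-z = λ c l → decidable-stable (c ≟ z) λ c≢z → return g c g≢z c≢z l
        in p≢q (trans (is-z p lp) (sym (is-z q lq)))
      go : ⊥
      go = a≢b (trans (special-is-z a ra) (sym (special-is-z b rb)))

-- By induction the tails agree, so only the first letters can differ. `L` varies in the induction
-- because `clash` descends to a derived language.
unique-special : (n : ℕ) {L : Word k → Set} → Language L → Bal L → OncePal L →
  ∀ u v → length u ≤ n → length u ≡ length v → RSpecial L u → RSpecial L v → u ≡ v
unique-special n lang bal once [] [] _ _ _ _ = refl
unique-special {k} (suc n) {L} lang bal once (a ∷ u) (b ∷ v) (s≤s le) len ru rv
  with refl ← unique-special n lang bal once u v le (suc-injective len)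
    (Language.special-suffix lang [ a ] u ru) (Language.special-suffix lang [ b ] v rv)
  = cong (_∷ u) (decidable-stable (a ≟ b) λ a≢b → clash u a≢b le ru rv)
  where
  open Language lang
  clash : ∀ u → a ≢ b → length u ≤ n → RSpecial L (a ∷ u) → RSpecial L (b ∷ u) → ⊥
  clash [] a≢b _ ru rv = special-letters-clash lang bal once a≢b ru rv
  clash (f ∷ u) a≢b le ru@(_ , _ , _ , lu , _) rv@(_ , _ , _ , lv , _)
    with s , x , es ← snoc-view f u =
    a≢b (descend (decode-closed lang hub u s (subst (λ f → L (f ∷ u)) f≡x lfu)
      (subst (λ f → f ∷ u ≡ s ++ [ x ]) f≡x es)))
    where
    lfu : L (f ∷ u)
    lfu = factor [ a ] (f ∷ u) _ lu
    1≤n : 1 ≤ n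
    1≤n = ≤-trans (s≤s z≤n) le
    rx : RSpecial L [ x ]
    rx = special-suffix (a ∷ s) [ x ] (subst (λ w → RSpecial L (a ∷ w)) es ru)
    -- The common tail is nonempty, so words of length 1 fall under the induction: `x` is the only
    -- right special letter and hence a hub.
    letter : ∀ c → RSpecial L [ c ] → c ≡ x
    letter c rc = ∷-injectiveˡ (unique-special n lang bal once [ c ] [ x ] 1≤n refl rc rx)
    hub : Hub x L
    hub = unique-special-letter⇒hub lang x (special-factor rx)
      λ c c≢x rc → c≢x (letter c rc)
    -- Reversing `a f` and `b f` shows that `f` is right special.
    f≡x : f ≡ x
    f≡x = letter f (a , b , a≢b , reversed _ (prefix (a ∷ f ∷ []) _ lu) , reversed _ (prefix (b ∷ f ∷ []) _ lv))
    -- The common tail begins and ends with `x`, so it is an image `Ψ x v`; the words `a ∷ v` and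
    -- `b ∷ v` are right special in the derived language and shorter.
    descend : (∃ λ v → x ∷ u ≡ Ψ x v) → a ≡ b
    descend (v , eq) = ∷-injectiveˡ (unique-special n (derived-language lang hub)
      (derived-balanced lang x bal) (derived-oncePal lang x once) (a ∷ v) (b ∷ v)
      (≤-trans (≤-trans (length<Ψ x v) (≤-reflexive (cong length (sym eq)))) le) refl
      (special-derived lang hub a v (subst (λ w → RSpecial L (a ∷ w)) eq′ ru))
      (special-derived lang hub b v (subst (λ w → RSpecial L (b ∷ w)) eq′ rv)))
      where
      eq′ : f ∷ u ≡ Ψ x v
      eq′ = trans (cong (_∷ u) f≡x) eq

-- Desubstitution of languages with unique right special words

module _ {L : Word k → Set} (lang : Language L) (uniq : UniqueRSpecial L) where
  open Language lang

  private
    -- Images of words of equal length may differ in length; the longer one has a right special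
    -- suffix as long as the shorter. So `u` is a suffix of `v`, and equal lengths leave nothing
    -- before it.
    derived-unique-≤ : ∀ {x} → Hub x L → ∀ u v → length u ≡ length v →
      RSpecial (Derived x L) u → RSpecial (Derived x L) v → length (Ψ x u) ≤ length (Ψ x v) → u ≡ v
    derived-unique-≤ {x} hub u v len ru rv le = cancel (Ψ-suffix v (take d (Ψ x v)) u
        (trans (sym (take++drop≡id d (Ψ x v))) (cong (take d (Ψ x v) ++_) same)))
      where
      d = length (Ψ x v) ∸ length (Ψ x u)
      same : drop d (Ψ x v) ≡ Ψ x u
      same = uniq _ _ (trans (length-drop d (Ψ x v)) (m∸[m∸n]≡n le))
        (special-suffix (take d (Ψ x v)) _
          (subst (RSpecial L) (sym (take++drop≡id d (Ψ x v))) (derived-special lang hub v rv)))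
        (derived-special lang hub u ru)
      cancel : (∃ λ s → v ≡ s ++ u) → u ≡ v
      cancel ([] , e) = sym e
      cancel (c ∷ s , refl) = contradiction
        (≤-trans (s≤s (m≤n+m (length u) (length s))) (≤-reflexive (trans (cong suc (sym (length-++ s))) (sym len)))) 1+n≰n

  derived-unique : ∀ {x} → Hub x L → UniqueRSpecial (Derived x L)
  derived-unique {x} hub u v len ru rv with ≤-total (length (Ψ x u)) (length (Ψ x v))
  ... | inj₁ le = derived-unique-≤ hub u v len ru rv le
  ... | inj₂ ge = sym (derived-unique-≤ hub v u (sym len) rv ru ge)

  -- A right special letter is a hub; if there is none, then any letter is one.
  ¬¬hub : ∀ c → L [ c ] → ¬ ¬ (∃ λ x → Hub x L)
  ¬¬hub c lc ¬hub = ¬hub (c , unique-special-letter⇒hub lang c lc λ a _ ra →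
    ¬hub (a , unique-special-letter⇒hub lang a (special-factor ra) λ b b≢a rb →
      b≢a (∷-injectiveˡ (uniq [ b ] [ a ] refl rb ra))))

-- An occurrence of `Ψ x p` starts with `x`, hence at a block boundary, and decodes to an occurrence
-- of `p` in `v`.
oncePalPrefix-Ψ : {x : Fin k} {e : Word k} → NotIn x e → (v : Word k) → OncePalPrefix v →
  OncePalPrefix (Ψ x v ++ e)
oncePalPrefix-Ψ {x = x} {e} x∉e v (p , (s , refl) , pal , o) =
  Ψ x p , (τ x s ++ e , trans (cong (_++ e) (Ψ-++′ x p s)) (++-assoc (Ψ x p) _ _)) ,
  palindrome-Ψ x pal , once
  where
  once : ∀ c s′ r → Ψ x (p ++ s) ++ e ≢ c ∷ s′ ++ Ψ x p ++ r
  once c s′ r eq with Ψ-split-at-x x∉e v (c ∷ s′) eq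
  ... | d ∷ u , v′ , ev , _ , ep with r′ , refl ← Ψ-prefix x∉e p v′ (sym ep) = o d u r′ ev

-- A palindrome of the derived word that starts with z ≠ x has an image of the form x M x, and it
-- is M that occurs once: each of its occurrences is surrounded by x.
oncePalPrefix-inner : {x z : Fin k} → z ≢ x → (q w f : Word k) → Ψ x q ≡ w ++ f →
  f ≡ [] ⊎ f ≡ [ x ] → OncePalPrefix (z ∷ q) → OncePalPrefix (z ∷ w)
oncePalPrefix-inner z≢x q w f eq f-case ([] , _ , _ , o) =
  contradiction (cong (_ ∷_) (sym (++-identityʳ q))) (o _ q [])
oncePalPrefix-inner {x = x} {z} z≢x q w f eq f-case (_ ∷ p , (s , refl) , pal , o) =
  M , isPrefix f-case , palM , once
  where
  open ≡-Reasoning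
  M = z ∷ ψ x p
  image : Ψ x (z ∷ p) ≡ x ∷ M ++ [ x ]
  image = cong (x ∷_) (trans (cong (_++ Ψ x p) (tl-≢ z≢x)) (cong (z ∷_) (Ψ-ψ x p)))
  palM : IsPalindrome M
  palM = proj₂ (strip-palindrome x M x (subst IsPalindrome image (palindrome-Ψ x pal)))
  M-last : M ≡ reverse (ψ x p) ++ [ z ]
  M-last = trans (sym palM) (unfold-reverse z (ψ x p))
  split : w ++ f ≡ ψ x p ++ Ψ x s
  split = trans (sym eq) (Ψ-++ x p s)
  isPrefix : f ≡ [] ⊎ f ≡ [ x ] → ∃ λ t → z ∷ w ≡ M ++ t
  isPrefix (inj₁ refl) = Ψ x s , cong (z ∷_) (trans (sym (++-identityʳ w)) split)
  isPrefix (inj₂ refl) with t , e ← prefix-of-init w (ψ x p) split = t , cong (z ∷_) e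
  once : ∀ c s′ r → z ∷ w ≢ c ∷ s′ ++ M ++ r
  -- The image is split at the first and at the last letter of `M`, both equal to `z`. What precedes
  -- `M` is an image and ends with `x`; what follows is an image and begins with `x`. So the
  -- occurrence extends to one of the image of `z ∷ p`.
  once c s′ r occ = finish (Ψ-split-at-other z≢x (z ∷ q) (x ∷ c ∷ s′) full)
    (Ψ-split-at-other z≢x (z ∷ q) ((x ∷ c ∷ s′) ++ reverse (ψ x p)) full′)
    where
    full : Ψ x (z ∷ q) ≡ (x ∷ c ∷ s′) ++ M ++ r ++ f
    full = begin
      Ψ x (z ∷ q)                     ≡⟨ cong (λ t → x ∷ t ++ Ψ x q) (tl-≢ z≢x) ⟩
      x ∷ z ∷ Ψ x q                   ≡⟨ cong (λ t → x ∷ z ∷ t) eq ⟩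
      x ∷ (z ∷ w) ++ f                ≡⟨ cong (λ t → x ∷ t ++ f) occ ⟩
      x ∷ (c ∷ s′ ++ M ++ r) ++ f     ≡⟨ cong (x ∷_) (++-assoc (c ∷ s′) (M ++ r) f) ⟩
      x ∷ c ∷ s′ ++ (M ++ r) ++ f     ≡⟨ cong (λ t → x ∷ c ∷ s′ ++ t) (++-assoc M r f) ⟩
      (x ∷ c ∷ s′) ++ M ++ r ++ f     ∎
    full′ : Ψ x (z ∷ q) ≡ ((x ∷ c ∷ s′) ++ reverse (ψ x p)) ++ z ∷ r ++ f
    full′ = begin
      Ψ x (z ∷ q)                                       ≡⟨ full ⟩
      (x ∷ c ∷ s′) ++ M ++ r ++ f                       ≡⟨ cong (λ m → (x ∷ c ∷ s′) ++ m ++ r ++ f) M-last ⟩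
      (x ∷ c ∷ s′) ++ (reverse (ψ x p) ++ [ z ]) ++ r ++ f ≡⟨ cong ((x ∷ c ∷ s′) ++_) (++-assoc (reverse (ψ x p)) [ z ] (r ++ f)) ⟩
      (x ∷ c ∷ s′) ++ reverse (ψ x p) ++ z ∷ r ++ f     ≡⟨ ++-assoc (x ∷ c ∷ s′) (reverse (ψ x p)) (z ∷ r ++ f) ⟨
      ((x ∷ c ∷ s′) ++ reverse (ψ x p)) ++ z ∷ r ++ f   ∎
    finish : (∃₂ λ u v → x ∷ c ∷ s′ ≡ Ψ x u × ψ x p ++ r ++ f ≡ Ψ x v) →
      (∃₂ λ u v → (x ∷ c ∷ s′) ++ reverse (ψ x p) ≡ Ψ x u × r ++ f ≡ Ψ x v) → ⊥
    -- Both `x` and `c` stand before `M`, too long for the image of the empty word; so the decoded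
    -- occurrence of `z ∷ p` is not at the start.
    finish ([] , _ , () , _) _
    finish (d ∷ u , _ , eu , _) (_ , v , _ , ev)
      with Ψ-split-at-x notIn-[] (z ∷ q) (ψ x (d ∷ u)) {M ++ r ++ f} (begin
        Ψ x (z ∷ q) ++ []               ≡⟨ ++-identityʳ _ ⟩
        Ψ x (z ∷ q)                     ≡⟨ full ⟩
        (x ∷ c ∷ s′) ++ M ++ r ++ f     ≡⟨ cong (_++ M ++ r ++ f) (trans eu (Ψ-ψ x (d ∷ u))) ⟩
        (ψ x (d ∷ u) ++ [ x ]) ++ M ++ r ++ f ≡⟨ ++-assoc (ψ x (d ∷ u)) [ x ] _ ⟩
        ψ x (d ∷ u) ++ x ∷ M ++ r ++ f  ∎)
    ... | d′ ∷ u′ , v′ , eq′ , _ , ev′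
      with r′ , refl ← Ψ-prefix notIn-[] (z ∷ p) v′ {τ x v} (begin
        Ψ x v′ ++ []              ≡⟨ ev′ ⟨
        x ∷ M ++ r ++ f           ≡⟨ cong (λ t → x ∷ M ++ t) ev ⟩
        x ∷ M ++ x ∷ τ x v        ≡⟨ cong (x ∷_) (++-assoc M [ x ] (τ x v)) ⟨
        (x ∷ M ++ [ x ]) ++ τ x v ≡⟨ cong (_++ τ x v) image ⟨
        Ψ x (z ∷ p) ++ τ x v      ∎) = o d′ u′ r′ eq′

oncePalPrefix-letter : (a : Fin k) → OncePalPrefix [ a ]
oncePalPrefix-letter a = [ a ] , ([] , refl) , refl , λ { _ [] _ () ; _ (_ ∷ _) _ () }

unique-special⇒oncePal : (n : ℕ) {L : Word k → Set} → Language L → UniqueRSpecial L →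
  ∀ w → length w ≤ n → L w → OncePalPrefix w
unique-special⇒oncePal n lang uniq [] _ _ = [] , ([] , refl) , refl , λ _ _ _ ()
unique-special⇒oncePal {k} (suc n) {L} lang uniq (a ∷ w) (s≤s le) l =
  decidable-stable (oncePalPrefix? (a ∷ w)) λ ¬once →
    ¬¬hub lang uniq a (prefix [ a ] w l) λ (x , hub) → ¬once (step x hub)
  where
  open Language lang
  -- Decoding shortens the word. A word beginning with `x` decodes directly; one beginning with
  -- another letter has lost the `x` that opens its first block.
  step : ∀ x → Hub x L → OncePalPrefix (a ∷ w)
  step x hub = by-first-letter w le l
    where
    IH : ∀ v → length v ≤ n → L (Ψ x v) → OncePalPrefix v
    IH = unique-special⇒oncePal n (derived-language lang hub) (derived-unique lang uniq hub)
    bound : ∀ {w} v e → x ∷ w ≡ Ψ x v ++ e → length v + length e ≤ length w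
    bound v e eq = ≤-pred (≤-trans (+-monoˡ-≤ (length e) (length<Ψ x v))
      (≤-reflexive (trans (sym (length-++ (Ψ x v))) (cong length (sym eq)))))
    from-x : ∀ w → length w ≤ n → L (x ∷ w) → OncePalPrefix (x ∷ w)
    from-x w le l with decode lang hub w l
    ... | v , inj₁ e = subst OncePalPrefix (trans (++-identityʳ _) (sym e))
      (oncePalPrefix-Ψ notIn-[] v (IH v
        (≤-trans (≤-trans (m≤m+n _ _) (bound v [] (trans e (sym (++-identityʳ _))))) le) (subst L e l)))
    ... | v , inj₂ (y , y≢x , e) = subst OncePalPrefix (sym e)
      (oncePalPrefix-Ψ (notIn-[y] y≢x) v (IH v
        (≤-trans (≤-trans (m≤m+n _ _) (bound v [ y ] e)) le) (prefix _ [ y ] (subst L e l))))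
    from-other : a ≢ x → ∀ w → suc (length w) ≤ n → L (a ∷ x ∷ w) → OncePalPrefix (a ∷ x ∷ w)
    from-other a≢x w le l with decode lang hub w (suffix [ a ] _ l)
    ... | v , inj₁ e = oncePalPrefix-inner a≢x v (x ∷ w) [] (trans (sym e) (sym (++-identityʳ _))) (inj₁ refl)
      (IH (a ∷ v) (≤-trans (s≤s (≤-trans (m≤m+n _ _) (bound v [] (trans e (sym (++-identityʳ _)))))) le)
        (lift-left lang hub a v (subst (λ w → L (a ∷ w)) e l)))
    -- The cut block of `y` is completed by an `x`, which the given word lacks: this is the
    -- remainder `[ x ]`.
    ... | v , inj₂ (y , y≢x , e) = oncePalPrefix-inner a≢x (v ++ [ y ]) (x ∷ w) [ x ]
      (trans (Ψ-∷ʳ-≢ v y≢x) (trans (sym (++-assoc (Ψ x v) [ y ] [ x ])) (cong (_++ [ x ]) (sym e)))) (inj₂ refl)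
      (IH (a ∷ v ++ [ y ]) (≤-trans (s≤s (≤-trans (≤-reflexive (length-++ v)) (bound v [ y ] e))) le)
        (lift-left lang hub a (v ++ [ y ]) (lift-right lang hub [ a ] v y (subst (λ w → L (a ∷ w)) e l))))
    by-first-letter : ∀ w → length w ≤ n → L (a ∷ w) → OncePalPrefix (a ∷ w)
    by-first-letter w le l with a ≟ x
    by-first-letter w le l | yes refl = from-x w le l
    by-first-letter [] _ _ | no _ = oncePalPrefix-letter a
    by-first-letter (b ∷ w) le l | no a≢x
      with refl ← hub a b (prefix (a ∷ b ∷ []) w l) a≢x = from-other a≢x w le l

-- Infinite words

length-slice : (t : InfWord k) (i n : ℕ) → length (slice t i n) ≡ n
length-slice t i zero = refl
length-slice t i (suc n) = cong suc (length-slice t (suc i) n)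

slice-++ : (t : InfWord k) (i m n : ℕ) → slice t i (m + n) ≡ slice t i m ++ slice t (i + m) n
slice-++ t i zero n = cong (λ j → slice t j n) (sym (+-identityʳ i))
slice-++ t i (suc m) n = cong (t i ∷_) (trans (slice-++ t (suc i) m n)
  (cong (λ j → slice t (suc i) m ++ slice t j n) (sym (+-suc i m))))

slice-occurs : (t : InfWord k) (i n : ℕ) → OccursAt t (slice t i n) i
slice-occurs t i n = cong (slice t i) (length-slice t i n)

occurs-++ : (t : InfWord k) (u v : Word k) (i : ℕ) → OccursAt t (u ++ v) i →
  OccursAt t u i × OccursAt t v (i + length u)
occurs-++ t [] v i o = refl , subst (OccursAt t v) (sym (+-identityʳ i)) o
occurs-++ t (c ∷ u) v i o with e , o′ ← ∷-injective o
  with ou , ov ← occurs-++ t u v (suc i) o′ =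
  cong₂ _∷_ e ou , subst (OccursAt t v) (sym (+-suc i (length u))) ov

occurs-join : (t : InfWord k) (u v : Word k) {i j : ℕ} → OccursAt t u i → OccursAt t v j →
  i + length u ≤ j → ∃ λ m → OccursAt t (u ++ m ++ v) i
occurs-join t u v {i} {j} ou ov le with d , refl ← m≤n⇒∃[o]m+o≡n le =
  m , (begin
    slice t i (length (u ++ m ++ v))             ≡⟨ cong (slice t i) (trans (length-++ u) (cong (length u +_) (trans (length-++ m) (cong (_+ length v) (length-slice t _ d))))) ⟩
    slice t i (length u + (d + length v))        ≡⟨ slice-++ t i (length u) (d + length v) ⟩
    slice t i (length u) ++ slice t (i + length u) (d + length v) ≡⟨ cong₂ _++_ ou (slice-++ t (i + length u) d (length v)) ⟩
    u ++ m ++ slice t (i + length u + d) (length v) ≡⟨ cong (λ w → u ++ m ++ w) ov ⟩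
    u ++ m ++ v                                  ∎)
  where
  open ≡-Reasoning
  m = slice t (i + length u) d

module _ (t : InfWord k) where

  factor-of-factor : ∀ u v w → IsFactor t (u ++ v ++ w) → IsFactor t v
  factor-of-factor u v w (i , o) = _ , proj₁ (occurs-++ t v w _ (proj₂ (occurs-++ t u (v ++ w) i o)))

  recurrent-joined : Recurrent t → ∀ u v → IsFactor t u → IsFactor t v → ∃ λ m → IsFactor t (u ++ m ++ v)
  recurrent-joined rec u v (i , ou) fv with j , le , ov ← rec v fv (i + length u)
    with m , o ← occurs-join t u v ou ov le = m , i , o

  ReversalClosed : Set
  ReversalClosed = ∀ u → IsFactor t u → IsFactor t (reverse u)

  language : Recurrent t → ReversalClosed → Language (IsFactor t)
  language rec rev = record
    { factor = factor-of-factor ; reversed = rev ; joined = recurrent-joined rec }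

  -- In u m u the palindromic prefix occurring once is longer than u, so it ends with the reverse of u.
  oncePal⇒reversalClosed : Recurrent t → OncePal (IsFactor t) → ReversalClosed
  oncePal⇒reversalClosed rec once [] f = f
  oncePal⇒reversalClosed rec once u@(a ∷ u₁) f
    with m , fm ← recurrent-joined rec u u f f
    with p , (s , eq) , pal , o ← once _ fm
    with prefixes-comparable p u (trans (sym eq) refl)
  ... | inj₁ (r , refl) = factor-of-factor (reverse r) (reverse u) s
    (subst (IsFactor t) (trans eq (trans (cong (_++ s) (trans (sym pal) (reverse-++ u r)))
      (++-assoc (reverse r) (reverse u) s))) fm)
  ... | inj₂ (r , e) = contradiction
    (cong (a ∷_) (trans (cong (λ v → u₁ ++ m ++ v) e) (sym (++-assoc u₁ m (p ++ r))))) (o a (u₁ ++ m) r)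

  -- Recurrence from closure under reversal

  module _ (rev : ReversalClosed) where

    private
      pre : ℕ → Word k
      pre = slice t 0

    -- The reversal of `pre (j + n)` begins with `pre n`. If it occurs at a positive position, so
    -- does `pre n`; if it occurs at 0, that prefix is a palindrome.
    reversed-prefix : ∀ n j → OccursAt t (reverse (pre n)) j →
      (∃ λ i → 1 ≤ i × OccursAt t (pre n) i) ⊎ IsPalindrome (pre (j + n))
    reversed-prefix n j o with rev (pre (j + n)) (0 , slice-occurs t 0 (j + n))
    ... | zero , o′ = inj₂ (trans (sym o′)
      (cong pre (trans (length-reverse (pre (j + n))) (length-slice t 0 (j + n)))))
    ... | suc i , o′ = inj₁ (suc i , s≤s z≤n , proj₁ (occurs-++ t (pre n) (reverse (pre j)) (suc i)
      (subst (λ w → OccursAt t w (suc i)) (begin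
        reverse (pre (j + n))            ≡⟨ cong reverse (slice-++ t 0 j n) ⟩
        reverse (pre j ++ slice t j n)   ≡⟨ cong (λ w → reverse (pre j ++ w)) at-j ⟩
        reverse (pre j ++ reverse (pre n)) ≡⟨ reverse-++ (pre j) _ ⟩
        reverse (reverse (pre n)) ++ reverse (pre j) ≡⟨ cong (_++ reverse (pre j)) (reverse-involutive (pre n)) ⟩
        pre n ++ reverse (pre j)         ∎) o′)))
      where
      open ≡-Reasoning
      at-j : slice t j n ≡ reverse (pre n)
      at-j = trans (cong (slice t j) (sym (trans (length-reverse (pre n)) (length-slice t 0 n)))) o

    -- Two palindromic prefixes of different lengths, both beginning with pre n: the shorter one is
    -- a suffix of the longer one, and pre n occurs there.
    prefix-recurs : ∀ n → ∃ λ i → 1 ≤ i × OccursAt t (pre n) i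
    prefix-recurs n
      with j , oj ← rev (pre n) (0 , slice-occurs t 0 n)
      -- The length `n + suc j` places the reversal of `pre n` at `i + suc j`, beyond `j`, so that
      -- the two palindromic prefixes differ in length.
      with i , oi ← rev (pre (n + suc j)) (0 , slice-occurs t 0 (n + suc j))
      with reversed-prefix n j oj | reversed-prefix n (i + suc j) (later i j oi)
      where
      later : ∀ i j → OccursAt t (reverse (pre (n + suc j))) i → OccursAt t (reverse (pre n)) (i + suc j)
      later i j o = subst (OccursAt t (reverse (pre n)))
        (cong (i +_) (trans (length-reverse (slice t n (suc j))) (length-slice t n (suc j))))
        (proj₂ (occurs-++ t (reverse (slice t n (suc j))) (reverse (pre n)) i
          (subst (λ w → OccursAt t w i)
            (trans (cong reverse (slice-++ t 0 n (suc j))) (reverse-++ (pre n) _)) o)))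
    ... | inj₁ found | _ = found
    ... | inj₂ _ | inj₁ found = found
    ... | inj₂ palA | inj₂ palB = suc i , s≤s z≤n , at-suc-i
      where
      C = slice t (j + n) (suc i)
      lengths : i + suc j + n ≡ (j + n) + suc i
      lengths = trans (+-assoc i (suc j) n) (trans (+-comm i (suc (j + n))) (sym (+-suc (j + n) i)))
      split : pre (i + suc j + n) ≡ reverse C ++ pre (j + n)
      split = trans (cong pre lengths) (trans (slice-++ t 0 (j + n) (suc i))
        (palindrome-border (pre (j + n)) C palA
          (subst IsPalindrome (trans (cong pre lengths) (slice-++ t 0 (j + n) (suc i))) palB)))
      A-occurs : OccursAt t (pre (j + n)) (suc i)
      A-occurs = subst (OccursAt t (pre (j + n)))
        (trans (length-reverse C) (length-slice t (j + n) (suc i)))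
        (proj₂ (occurs-++ t (reverse C) (pre (j + n)) 0
          (subst (λ w → OccursAt t w 0) split (slice-occurs t 0 (i + suc j + n)))))
      at-suc-i : OccursAt t (pre n) (suc i)
      at-suc-i = proj₁ (occurs-++ t (pre n) (slice t n j) (suc i)
        (subst (λ w → OccursAt t w (suc i)) (trans (cong pre (+-comm j n)) (slice-++ t 0 n j)) A-occurs))

    -- A second occurrence at `j` of the prefix of length `i + n` carries the occurrence of `pre n`
    -- at `i` to `j + i`, which is larger.
    prefix-recurs-beyond : ∀ N n → ∃ λ i → N ≤ i × OccursAt t (pre n) i
    prefix-recurs-beyond zero n = 0 , z≤n , slice-occurs t 0 n
    prefix-recurs-beyond (suc N) n
      with i , N≤i , oi ← prefix-recurs-beyond N n
      with j , 1≤j , oj ← prefix-recurs (i + n) =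
      j + i , +-mono-≤ 1≤j N≤i ,
      subst (OccursAt t (pre n)) (cong (j +_) (length-slice t 0 i))
        (proj₂ (occurs-++ t (pre i) (pre n) j (subst (λ w → OccursAt t w j)
          (trans (slice-++ t 0 i n) (cong (pre i ++_)
            (trans (cong (slice t i) (sym (length-slice t 0 n))) oi))) oj)))

    -- Every factor ends some prefix, and prefixes recur arbitrarily far to the right.
    reversalClosed⇒recurrent : Recurrent t
    reversalClosed⇒recurrent u (i , o) N
      with j , N≤j , oj ← prefix-recurs-beyond N (i + length u) =
      j + i , m≤n⇒m≤n+o i N≤j ,
      subst (OccursAt t u) (cong (j +_) (length-slice t 0 i))
        (proj₂ (occurs-++ t (pre i) u j (subst (λ w → OccursAt t w j)
          (trans (slice-++ t 0 i (length u)) (cong (pre i ++_) o)) oj)))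

  -- The two implications

  rich⇒episturmian : Recurrent t → Balanced t → Rich t → Episturmian t
  rich⇒episturmian rec bal rich = rev , λ { _ u v refl len ru rv →
      unique-special (length u) (language rec rev)
        (λ u v fu fv len a → proj₁ (bal u v fu fv len a)) once u v ≤-refl (sym len) ru rv }
    where
    once : OncePal (IsFactor t)
    once w f = rich⇒oncePalPrefix w (rich w f)
    rev : ReversalClosed
    rev = oncePal⇒reversalClosed rec once

  episturmian⇒recurrent : Episturmian t → Recurrent t
  episturmian⇒recurrent (rev , _) = reversalClosed⇒recurrent rev

  episturmian⇒rich : Episturmian t → Rich t
  episturmian⇒rich epi@(rev , uniq) u f = oncePalPrefix⇒rich u λ x v e →
    unique-special⇒oncePal (length v) lang
      (λ u v len → uniq (length u) u v refl (sym len)) v ≤-refl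
      (Language.suffix lang x v (subst (IsFactor t) e f))
    where
    lang : Language (IsFactor t)
    lang = language (episturmian⇒recurrent epi) rev

theorem5p2 : (k : ℕ) (t : InfWord k) →
    (Recurrent t × Balanced t × Rich t) ⇔ (Balanced t × Episturmian t)
theorem5p2 k t = mk⇔
  (λ (rec , bal , rich) → bal , rich⇒episturmian t rec bal rich)
  (λ (bal , epi) → episturmian⇒recurrent t epi , bal , episturmian⇒rich t epi)
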